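{- Let $G=(V,E)$ be a finite undirected graph (multiple edges and loops allowed), let $q$ be an arbitrary (complex) number, and let $\bm v=(v_e)_{e\in E}$ and $\bm u=(u_e)_{e\in E}$ be arbitrary sequences of (complex) numbers indexed by $E$. Then the following two identities hold. (1) If $v_e\neq 0$ and $u_e\neq 0$ for all $e\in E$, then $$Z(G;q,\bm v)=\Big(\prod_{e\in E}\frac{v_e}{u_e}\Big)\sum_{F\subseteq E}\Big(\prod_{e\in F}\Big(\frac{u_e}{v_e}-1\Big)\Big)\,Z\big(G-F;q,(u_e)_{e\in E-F}\big).$$ (2) With no nonvanishing assumption, $$Z(G;q,\bm v)=\sum_{F\subseteq E}\Big(\prod_{e\in F}(v_e-u_e)\Big)\,Z\big(G/F;q,(u_e)_{e\in E-F}\big).$$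
   Context: Graphs are finite, undirected, and may have loops and multiple edges. For a graph $G=(V,E)$, a number $q$ and a sequence $\bm v=(v_e)_{e\in E}$ of numbers, the Potts model partition function (multivariate Tutte polynomial) is $$Z(G;q,\bm v)=\sum_{A\subseteq E}q^{k_G(A)}\prod_{e\in A}v_e,$$ where $k_G(A)$ is the number of connected components of the spanning subgraph $(V,A)$. Empty products equal $1$. For $F\subseteq E$: $G-F=(V,E-F)$ is the graph obtained by deleting all edges in $F$ (keeping all vertices). $G/F$ is the graph with edge set $E-F$ obtained by contracting all edges in $F$; that is, its vertices are the connected components of $(V,F)$, and each edge $e\in E-F$ joins the components containing its endpoints. Loops and multiple edges arising from contraction are kept. -}

module Defs where

open import Algebra.Apartness.Bundles using (HeytingField; HeytingCommutativeRing)
open import Algebra.Bundles using (CommutativeRing; Semiring)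
import Algebra.Definitions.RawSemiring as RawSemiringDefinitions
import Algebra.Properties.AbelianGroup as AbelianGroupProperties
open import Data.Fin.Base using (Fin; zero; suc; punchIn; punchOut)
open import Data.Fin.Properties
  using (_≟_; punchInᵢ≢i; punchOut-cong; punchOut-injective; punchOut-punchIn)
open import Data.Fin.Subset using (Subset; inside; outside; _∈_; ∁; ∣_∣)
open import Data.Nat.Base using (ℕ; zero; suc)
open import Data.Product.Base using (_×_; _,_; ∃-syntax; proj₁; proj₂) renaming (map to ×-map)
open import Data.Vec.Base using ([]; _∷_; here; there)
open import Function.Base using (_∘_; id)
open import Level using (0ℓ)
open import Relation.Binary.Core using (Rel; _⇒_)
open import Relation.Binary.Construct.Closure.Equivalence as Eq using (EqClosure)
open import Relation.Binary.PropositionalEquality.Core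
  using (_≡_; _≢_; refl; sym; trans; cong)
open import Relation.Binary.PropositionalEquality.Properties using (isEquivalence)
open import Relation.Nullary.Decidable.Core using (yes; no)
open import Relation.Nullary.Negation.Core using (contradiction)

-- The order of the two endpoints of an edge carries no meaning: edges are
-- only ever used through the symmetric relation `Connected` below.
record Graph : Set where
  constructor graph
  field
    V    : ℕ
    E    : ℕ
    ends : Fin E → Fin V × Fin V

open Graph public

-- `Connected ends A x y` says that x and y lie in the same connected
-- component of the spanning subgraph with edge set A.
Joined : ∀ {n m} → (Fin m → Fin n × Fin n) → Subset m → Rel (Fin n) 0ℓ
Joined ends A x y = ∃[ e ] e ∈ A × ends e ≡ (x , y)

Connected : ∀ {n m} → (Fin m → Fin n × Fin n) → Subset m → Rel (Fin n) 0ℓ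
Connected ends A = EqClosure (Joined ends A)

-- The set of classes of an equivalence relation on Fin n, presented as
-- Fin number: `class` is onto and its kernel is the given relation.  This
-- determines `number`, and determines `class` up to a permutation.
record Classes {n} (_∼_ : Rel (Fin n) 0ℓ) : Set where
  field
    number     : ℕ
    class      : Fin n → Fin number
    surjective : ∀ c → ∃[ x ] class x ≡ c
    sound      : ∀ {x y} → class x ≡ class y → x ∼ y
    complete   : ∀ {x y} → x ∼ y → class x ≡ class y

private
  -- Identify the two elements a and b of Fin k.
  module Merge {k} (a b : Fin (suc k)) (a≢b : a ≢ b) where

    rep : Fin (suc k) → Fin (suc k)
    rep z with z ≟ b
    ... | yes _ = a
    ... | no  _ = z

    b≢rep : ∀ z → b ≢ rep z
    b≢rep z with z ≟ b
    ... | yes _   = a≢b ∘ sym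
    ... | no  z≢b = z≢b ∘ sym

    rep-other : ∀ {z} → z ≢ b → rep z ≡ z
    rep-other {z} z≢b with z ≟ b
    ... | yes z≡b = contradiction z≡b z≢b
    ... | no  _   = refl

    rep-b : rep b ≡ a
    rep-b with b ≟ b
    ... | yes _   = refl
    ... | no  b≢b = contradiction refl b≢b

    merge : Fin (suc k) → Fin k
    merge z = punchOut (b≢rep z)

    merge-sound : ∀ y z → merge y ≡ merge z → rep y ≡ rep z
    merge-sound y z = punchOut-injective (b≢rep y) (b≢rep z)

    merge-onto : ∀ c → merge (punchIn b c) ≡ c
    merge-onto c = trans (punchOut-cong b (rep-other (punchInᵢ≢i b c))) (punchOut-punchIn b)

    merge-ab : merge a ≡ merge b
    merge-ab = punchOut-cong b (trans (rep-other a≢b) (sym rep-b))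

  joinedˢ : ∀ {n m} {ends : Fin (suc m) → Fin n × Fin n} {s A} →
            Joined (ends ∘ suc) A ⇒ Joined ends (s ∷ A)
  joinedˢ (e , e∈A , eq) = suc e , there e∈A , eq

  joinedᵒ : ∀ {n m} {ends : Fin (suc m) → Fin n × Fin n} {A} →
            Joined ends (outside ∷ A) ⇒ Joined (ends ∘ suc) A
  joinedᵒ (suc e , there e∈A , eq) = e , e∈A , eq

  -- Adding one edge to a subgraph merges the components of its endpoints.
  addEdge : ∀ {n m} (ends : Fin (suc m) → Fin n × Fin n) A →
            Classes (Connected (ends ∘ suc) A) → Classes (Connected ends (inside ∷ A))
  addEdge {n} ends A record { number = k ; class = f ; surjective = onto ; sound = snd ; complete = cmp }
    = add k f onto snd cmp
    where
    x₀ y₀ : Fin n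
    x₀ = proj₁ (ends zero)
    y₀ = proj₂ (ends zero)

    C : Rel (Fin n) 0ℓ
    C = Connected ends (inside ∷ A)

    C-refl : ∀ {x} → C x x
    C-refl = Eq.reflexive _

    C-sym : ∀ {x y} → C x y → C y x
    C-sym = Eq.symmetric _

    C-trans : ∀ {x y z} → C x y → C y z → C x z
    C-trans = Eq.transitive _

    x₀∼y₀ : C x₀ y₀
    x₀∼y₀ = Eq.return (zero , here , refl)

    respects : ∀ {j} (g : Fin n → Fin j) → g x₀ ≡ g y₀ →
               (∀ {x y} → Connected (ends ∘ suc) A x y → g x ≡ g y) →
               ∀ {x y} → C x y → g x ≡ g y
    respects g base step = Eq.gfold isEquivalence g λ where
      (zero  , here      , refl) → base
      (suc e , there e∈A , eq)   → step (Eq.return (e , e∈A , eq))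

    add : ∀ k (f : Fin n → Fin k) → (∀ c → ∃[ x ] f x ≡ c) →
          (∀ {x y} → f x ≡ f y → Connected (ends ∘ suc) A x y) →
          (∀ {x y} → Connected (ends ∘ suc) A x y → f x ≡ f y) →
          Classes C
    add zero    f onto snd cmp with () ← f x₀
    add (suc k) f onto snd cmp with f x₀ ≟ f y₀
    ... | yes eq = record
      { number     = suc k
      ; class      = f
      ; surjective = onto
      ; sound      = λ p → Eq.map joinedˢ (snd p)
      ; complete   = respects f eq cmp
      }
    ... | no neq = record
      { number     = k
      ; class      = merge ∘ f
      ; surjective = λ c → let (x , eq) = onto (punchIn (f y₀) c) in
                           x , trans (cong merge eq) (merge-onto c)
      ; sound      = λ {x} {y} p →
          let (x′ , x∼x′ , p′) = lift x
              (y′ , y∼y′ , q′) = lift y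
              fx′≡fy′          = trans p′ (trans (merge-sound (f x) (f y) p) (sym q′))
          in C-trans x∼x′ (C-trans (Eq.map joinedˢ (snd fx′≡fy′)) (C-sym y∼y′))
      ; complete   = respects (merge ∘ f) merge-ab (cong merge ∘ cmp)
      }
      where
      open Merge (f x₀) (f y₀) neq

      lift : ∀ x → ∃[ x′ ] C x x′ × f x′ ≡ rep (f x)
      lift x with f x ≟ f y₀
      ... | yes eq = x₀ , C-trans (Eq.map joinedˢ (snd eq)) (C-sym x₀∼y₀) , refl
      ... | no  _  = x , C-refl , refl

components : ∀ {n m} (ends : Fin m → Fin n × Fin n) (A : Subset m) → Classes (Connected ends A)
components {n} ends [] = record
  { number     = n
  ; class      = id
  ; surjective = λ c → c , refl
  ; sound      = λ { refl → Eq.reflexive _ }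
  ; complete   = Eq.fold isEquivalence λ { (() , _) }
  }
components ends (outside ∷ A) = record
  { number     = number
  ; class      = class
  ; surjective = surjective
  ; sound      = Eq.map joinedˢ ∘ sound
  ; complete   = complete ∘ Eq.map joinedᵒ
  }
  where open Classes (components (ends ∘ suc) A)
components ends (inside ∷ A) = addEdge ends A (components (ends ∘ suc) A)

k : (G : Graph) → Subset (E G) → ℕ
k G A = Classes.number (components (ends G) A)

component : (G : Graph) (A : Subset (E G)) → Fin (V G) → Fin (k G A)
component G A = Classes.class (components (ends G) A)

-- The increasing enumeration of the elements of a subset.
element : ∀ {n} (p : Subset n) → Fin ∣ p ∣ → Fin n
element (outside ∷ p) i       = suc (element p i)
element (inside  ∷ p) zero    = zero
element (inside  ∷ p) (suc i) = suc (element p i)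

-- The edges of G - F and of G / F are the edges of G outside F, renumbered:
-- their i-th edge is the edge `element (∁ F) i` of G.
infixl 6 _-ᴳ_
infixl 7 _/ᴳ_

_-ᴳ_ : (G : Graph) → Subset (E G) → Graph
G -ᴳ F = graph (V G) ∣ ∁ F ∣ (ends G ∘ element (∁ F))

_/ᴳ_ : (G : Graph) → Subset (E G) → Graph
G /ᴳ F = graph (k G F) ∣ ∁ F ∣ (×-map (component G F) (component G F) ∘ ends G ∘ element (∁ F))

-- The family indexed by the complement of F, numbered as the edges of
-- G - F and G / F are.
_∖_ : ∀ {a} {X : Set a} {n} → (Fin n → X) → (F : Subset n) → Fin ∣ ∁ F ∣ → X
u ∖ F = u ∘ element (∁ F)

module Potts {c ℓ₁ ℓ₂} (K : HeytingField c ℓ₁ ℓ₂) where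

  open HeytingField K
    using (Carrier; _≈_; _#_; _+_; _*_; -_; _-_; 0#; 1#; #⇒invertible; heytingCommutativeRing)

  private
    ring : CommutativeRing c ℓ₁
    ring = HeytingCommutativeRing.commutativeRing heytingCommutativeRing

    module R = CommutativeRing ring

  open RawSemiringDefinitions (Semiring.rawSemiring R.semiring) using (_^_; product)

  -- Nonvanishing is apartness from 0.  The field axioms give an inverse of
  -- y - 0#, which is an inverse of y.
  infixl 7 _/_⟨_⟩
  _/_⟨_⟩ : (x y : Carrier) → y # 0# → Carrier
  x / y ⟨ y#0 ⟩ = x * proj₁ (#⇒invertible y#0)

  /-cancel : ∀ x y (y#0 : y # 0#) → (x / y ⟨ y#0 ⟩) * y ≈ x
  /-cancel x y y#0 with (y⁻¹ , left , _) ← #⇒invertible y#0 =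
    R.trans (R.*-assoc x y⁻¹ y)
      (R.trans (R.*-congˡ (R.trans (R.*-congˡ (R.sym y-0≈y)) left)) (R.*-identityʳ x))
    where
    y-0≈y : y - 0# ≈ y
    y-0≈y = R.trans (R.+-congˡ (AbelianGroupProperties.ε⁻¹≈ε R.+-abelianGroup)) (R.+-identityʳ y)

  ∏ : ∀ {m} → Subset m → (Fin m → Carrier) → Carrier
  ∏ A f = product (f ∘ element A)

  -- The sum over all subsets of Fin m.
  ∑ : ∀ {m} → (Subset m → Carrier) → Carrier
  ∑ {zero}  f = f []
  ∑ {suc m} f = ∑ (λ A → f (outside ∷ A)) + ∑ (λ A → f (inside ∷ A))

  syntax ∏ A (λ e → x) = ∏[ e ∈ A ] x
  syntax ∑ (λ A → x) = ∑[ A ] x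

  Z : (G : Graph) → Carrier → (Fin (E G) → Carrier) → Carrier
  Z G q v = ∑[ A ] (q ^ k G A * (∏[ e ∈ A ] v e))

{-# OPTIONS --safe #-}
module Submission where

-- Both identities are the expansion of a product over edges.  A pair of F and
-- B ⊆ E - F contributes to Z(G - F) through the subgraph B of G, and to
-- Z(G / F) through the subgraph F ∪ B of G.  For a fixed subgraph A of G, the
-- weights of all the pairs that give A multiply up edge by edge: in (2) to
-- (v - u) + u = v on A and to 1 off A, and in (1) to u on A and to
-- 1 + (u/v - 1) = u/v off A, which the prefactor v/u turns into v and 1.

open import Defs
open import Algebra.Apartness.Bundles using (HeytingField)
open import Algebra.Bundles using (CommutativeRing; Semiring)
import Algebra.Definitions.RawSemiring as RawSemiringDefinitions
import Algebra.Properties.CommutativeSemigroup as CommutativeSemigroupProperties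
import Algebra.Properties.Group as GroupProperties
import Algebra.Solver.Ring.NaturalCoefficients.Default as Solver
open import Data.Bool.Base using (Bool)
open import Data.Fin.Base using (Fin; zero; suc)
open import Data.Fin.Properties using (injective⇒≤)
open import Data.Fin.Subset using (Subset; inside; outside; _∈_; ∁; ∣_∣; ⊤)
open import Data.Nat.Base using (zero; suc; _≤_)
open import Data.Nat.Properties using (≤-antisym)
open import Data.Product.Base using (_×_; _,_; ∃-syntax; proj₁; proj₂)
open import Data.Sum.Base using (_⊎_; inj₁; inj₂)
open import Data.Vec.Base using ([]; _∷_; here; there)
open import Function.Base using (_∘_; id)
open import Level using (0ℓ)
open import Relation.Binary.Core using (Rel; _⇒_)
import Relation.Binary.Construct.Closure.Equivalence as Eq
open import Relation.Binary.PropositionalEquality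
  using (_≡_; refl; sym; trans; cong; subst₂)
import Relation.Binary.Reasoning.Setoid as SetoidReasoning

-- Component counts of deletions and contractions.

-- Picking a representative of each class, applying `f` and taking the class of the result is
-- injective, because `f` reflects the relations. Used in both directions, the bound yields equality
-- of component counts.
number-mono : ∀ {n n′} {_∼_ : Rel (Fin n) 0ℓ} {_∼′_ : Rel (Fin n′) 0ℓ}
              (C : Classes _∼_) (D : Classes _∼′_) (f : Fin n → Fin n′) →
              (∀ {x y} → f x ∼′ f y → x ∼ y) → Classes.number C ≤ Classes.number D
number-mono C D f reflects = injective⇒≤ {f = D.class ∘ f ∘ rep} λ {i} {j} eq →
  trans (sym (proj₂ (C.surjective i)))
    (trans (C.complete (reflects (D.sound eq))) (proj₂ (C.surjective j)))
  where
  module C = Classes C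
  module D = Classes D
  rep : Fin C.number → Fin _
  rep i = proj₁ (C.surjective i)

-- The subset of Fin m that agrees with B outside F, and that contains all
-- of F or none of it according to x.
fill : ∀ {m} → Bool → (F : Subset m) → Subset ∣ ∁ F ∣ → Subset m
fill x []            []      = []
fill x (outside ∷ F) (b ∷ B) = b ∷ fill x F B
fill x (inside  ∷ F) B       = x ∷ fill x F B

element∈fill : ∀ {m} x (F : Subset m) {B i} → i ∈ B → element (∁ F) i ∈ fill x F B
element∈fill x (outside ∷ F) here        = here
element∈fill x (outside ∷ F) (there i∈B) = there (element∈fill x F i∈B)
element∈fill x (inside  ∷ F) i∈B         = there (element∈fill x F i∈B)

⊆fill-inside : ∀ {m} (F : Subset m) {B e} → e ∈ F → e ∈ fill inside F B
⊆fill-inside (inside  ∷ F)         here        = here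
⊆fill-inside (inside  ∷ F)         (there e∈F) = there (⊆fill-inside F e∈F)
⊆fill-inside (outside ∷ F) {_ ∷ _} (there e∈F) = there (⊆fill-inside F e∈F)

∈fill⁻ : ∀ {m} x (F : Subset m) {B e} → e ∈ fill x F B →
         (x ≡ inside × e ∈ F) ⊎ (∃[ i ] i ∈ B × element (∁ F) i ≡ e)
∈fill⁻ x (outside ∷ F) {_ ∷ _} here = inj₂ (zero , here , refl)
∈fill⁻ x (outside ∷ F) {_ ∷ _} (there e∈) with ∈fill⁻ x F e∈
... | inj₁ (x≡ , e∈F)     = inj₁ (x≡ , there e∈F)
... | inj₂ (i , i∈B , eq) = inj₂ (suc i , there i∈B , cong suc eq)
∈fill⁻ x (inside ∷ F) here = inj₁ (refl , here)
∈fill⁻ x (inside ∷ F) (there e∈) with ∈fill⁻ x F e∈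
... | inj₁ (x≡ , e∈F)     = inj₁ (x≡ , there e∈F)
... | inj₂ (i , i∈B , eq) = inj₂ (i , i∈B , cong suc eq)

-- Both graphs have the same vertices, and `element (∁ F)` matches the edges in `B` with those in
-- `fill outside F B`, so the identity reflects connectivity both ways.
k-delete : ∀ G F B → k (G -ᴳ F) B ≡ k G (fill outside F B)
k-delete G F B = ≤-antisym
  (number-mono C′ C id (Eq.map from))
  (number-mono C C′ id (Eq.map to))
  where
  C  = components (ends G) (fill outside F B)
  C′ = components (ends (G -ᴳ F)) B

  to : Joined (ends (G -ᴳ F)) B ⇒ Joined (ends G) (fill outside F B)
  to (i , i∈B , eq) = element (∁ F) i , element∈fill outside F i∈B , eq

  from : Joined (ends G) (fill outside F B) ⇒ Joined (ends (G -ᴳ F)) B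
  from (e , e∈ , eq) with ∈fill⁻ outside F e∈
  ... | inj₁ (() , _)
  ... | inj₂ (i , i∈B , refl) = i , i∈B , eq

-- `rep` and `class` both carry paths to paths. One composite is the identity, and the other moves a
-- vertex only within its component of `F`; hence each map reflects connectivity.
k-contract : ∀ G F B → k (G /ᴳ F) B ≡ k G (fill inside F B)
k-contract G F B = ≤-antisym
  (number-mono C′ C rep λ {a} {b} p →
    subst₂ (Connected (ends (G /ᴳ F)) B) (class-rep a) (class-rep b) (to p))
  (number-mono C C′ class λ {x} {y} p →
    transitive (symmetric (rep-class x)) (transitive (from p) (rep-class y)))
  where
  open Classes (components (ends G) F)
  C  = components (ends G) (fill inside F B)
  C′ = components (ends (G /ᴳ F)) B
  _~_ = Connected (ends G) (fill inside F B)
  symmetric  = Eq.symmetric (Joined (ends G) (fill inside F B))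
  transitive = Eq.transitive (Joined (ends G) (fill inside F B))

  rep : Fin number → Fin (V G)
  rep a = proj₁ (surjective a)

  class-rep : ∀ a → class (rep a) ≡ a
  class-rep a = proj₂ (surjective a)

  rep-class : ∀ x → rep (class x) ~ x
  rep-class x = Eq.map (λ { (e , e∈F , eq) → e , ⊆fill-inside F e∈F , eq })
                       (sound (class-rep (class x)))

  to : ∀ {x y} → x ~ y → Connected (ends (G /ᴳ F)) B (class x) (class y)
  to = Eq.gfold (Eq.isEquivalence _) class λ { (_ , e∈ , eq) → step e∈ eq }
    where
    step : ∀ {e x y} → e ∈ fill inside F B → ends G e ≡ (x , y) →
           Connected (ends (G /ᴳ F)) B (class x) (class y)
    step {e} {x} {y} e∈ eq with ∈fill⁻ inside F e∈
    -- An edge of `F` has both ends in one class, so it becomes the empty path.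
    ... | inj₁ (_ , e∈F) rewrite complete (Eq.return {x = x} {y = y} (e , e∈F , eq)) =
      Eq.reflexive _
    ... | inj₂ (i , i∈B , refl) =
      Eq.return (i , i∈B , cong (λ p → class (proj₁ p) , class (proj₂ p)) eq)

  from : ∀ {a b} → Connected (ends (G /ᴳ F)) B a b → rep a ~ rep b
  from = Eq.gfold (Eq.isEquivalence _) rep λ where
    -- The chosen representatives need not be the ends of the edge of `G`, so the path is completed
    -- inside `F` at both ends.
    (i , i∈B , refl) →
      transitive (rep-class _)
        (transitive (Eq.return (element (∁ F) i , element∈fill inside F i∈B , refl))
          (symmetric (rep-class _)))

module Expansion {c ℓ₁ ℓ₂} (K : HeytingField c ℓ₁ ℓ₂) where

  open HeytingField K using (_#_)
  open Potts K

  R : CommutativeRing c ℓ₁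
  R = record { isCommutativeRing = HeytingField.isCommutativeRing K }

  open CommutativeRing R
    hiding (zero) renaming (refl to ≈-refl; sym to ≈-sym; trans to ≈-trans)
  open RawSemiringDefinitions (Semiring.rawSemiring semiring) using (_^_)
  open SetoidReasoning setoid
  open CommutativeSemigroupProperties *-commutativeSemigroup using (x∙yz≈y∙xz)
  open Solver commutativeSemiring using (solve; _:=_; _:+_; _:*_; con)

  -- Linearity of sums over subsets.

  ∑-cong : ∀ {m} {f g : Subset m → Carrier} → (∀ A → f A ≈ g A) → ∑ f ≈ ∑ g
  ∑-cong {zero}  f≈g = f≈g []
  ∑-cong {suc m} f≈g = +-cong (∑-cong (f≈g ∘ (outside ∷_))) (∑-cong (f≈g ∘ (inside ∷_)))

  ∑-linear : ∀ {m} a (f g : Subset m → Carrier) → ∑[ A ] (f A + a * g A) ≈ ∑ f + a * ∑ g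
  ∑-linear {zero}  a f g = ≈-refl
  ∑-linear {suc m} a f g = begin
    ∑ (λ A → fₒ A + a * gₒ A) + ∑ (λ A → fᵢ A + a * gᵢ A)
      ≈⟨ +-cong (∑-linear a fₒ gₒ) (∑-linear a fᵢ gᵢ) ⟩
    (∑ fₒ + a * ∑ gₒ) + (∑ fᵢ + a * ∑ gᵢ)
      ≈⟨ solve 5 (λ a p q r s → (p :+ a :* q) :+ (r :+ a :* s) := (p :+ r) :+ a :* (q :+ s))
           ≈-refl a (∑ fₒ) (∑ gₒ) (∑ fᵢ) (∑ gᵢ) ⟩
    ∑ f + a * ∑ g ∎
    where
    fₒ = f ∘ (outside ∷_)
    fᵢ = f ∘ (inside ∷_)
    gₒ = g ∘ (outside ∷_)
    gᵢ = g ∘ (inside ∷_)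

  ∑-distribˡ : ∀ {m} a (f : Subset m → Carrier) → ∑[ A ] (a * f A) ≈ a * ∑ f
  ∑-distribˡ {zero}  a f = ≈-refl
  ∑-distribˡ {suc m} a f =
    ≈-trans (+-cong (∑-distribˡ a (f ∘ (outside ∷_))) (∑-distribˡ a (f ∘ (inside ∷_))))
            (≈-sym (distribˡ a _ _))

  -- Expansion edge by edge.

  -- With `h A = q ^ k G A` this is `Z G q v`. An arbitrary `h` lets the induction on edges run
  -- without rebuilding graphs: fixing the state of edge `zero` replaces `h` by `h ∘ (b ∷_)`.
  weighted : ∀ {m} → (Subset m → Carrier) → (Fin m → Carrier) → Carrier
  weighted h v = ∑[ A ] (h A * (∏[ e ∈ A ] v e))

  -- The common form of both sums over `F`, read in `G`: `x` is `outside` for deletion and `inside`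
  -- for contraction.
  pairs : ∀ {m} → Bool → (Subset m → Carrier) → (w u : Fin m → Carrier) → Carrier
  pairs x h w u = ∑[ F ] ((∏[ e ∈ F ] w e) * weighted (h ∘ fill x F) (u ∖ F))

  weighted-suc : ∀ {m} (h : Subset (suc m) → Carrier) v →
    weighted h v ≈ weighted (h ∘ (outside ∷_)) (v ∘ suc) +
                   v zero * weighted (h ∘ (inside ∷_)) (v ∘ suc)
  weighted-suc {m} h v = +-congˡ (≈-trans
    (∑-cong λ (A : Subset m) → x∙yz≈y∙xz (h (inside ∷ A)) (v zero) (∏[ e ∈ A ] v (suc e)))
    (∑-distribˡ (v zero) λ A → h (inside ∷ A) * (∏[ e ∈ A ] v (suc e))))

  -- Edge `zero` lies in neither set, in `B`, or in `F`, whence the three terms. In the last case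
  -- `x` decides whether it belongs to the subgraph, hence `P x`.
  pairs-suc : ∀ {m} x (h : Subset (suc m) → Carrier) w u →
    let P = λ b → pairs x (h ∘ (b ∷_)) (w ∘ suc) (u ∘ suc)
    in pairs x h w u ≈ (P outside + u zero * P inside) + w zero * P x
  pairs-suc {m} x h w u = +-cong
    (≈-trans (∑-cong outsideTerm) (∑-linear (u zero) (term outside) (term inside)))
    (≈-trans (∑-cong λ F → *-assoc (w zero) (W F) (rest x F)) (∑-distribˡ (w zero) (term x)))
    where
    W : Subset m → Carrier
    W F = ∏[ e ∈ F ] w (suc e)
    rest term : Bool → Subset m → Carrier
    rest b F = weighted (λ B → h (b ∷ fill x F B)) ((u ∘ suc) ∖ F)
    term b F = W F * rest b F
    outsideTerm : ∀ F → W F * weighted (h ∘ fill x (outside ∷ F)) (u ∖ (outside ∷ F)) ≈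
                        term outside F + u zero * term inside F
    outsideTerm F = ≈-trans
      (*-congˡ (weighted-suc (h ∘ fill x (outside ∷ F)) (u ∖ (outside ∷ F))))
      (≈-trans (distribˡ _ _ _) (+-congˡ (x∙yz≈y∙xz _ _ _)))

  -- Here the states "in `B`" and "in `F`" both lead to `P inside`, so their coefficients `u zero`
  -- and `w zero` add up to `v zero`.
  pairs-inside : ∀ {m} (h : Subset m → Carrier) {w u v} → (∀ e → w e + u e ≈ v e) →
                 pairs inside h w u ≈ weighted h v
  pairs-inside {zero}  h w+u≈v = *-identityˡ _
  pairs-inside {suc m} h {w} {u} {v} w+u≈v = begin
    pairs inside h w u
      ≈⟨ pairs-suc inside h w u ⟩
    (P outside + u zero * P inside) + w zero * P inside
      ≈⟨ solve 4 (λ w u p q → (p :+ u :* q) :+ w :* q := p :+ (w :+ u) :* q)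
           ≈-refl (w zero) (u zero) (P outside) (P inside) ⟩
    P outside + (w zero + u zero) * P inside
      ≈⟨ +-cong (ih outside) (*-cong (w+u≈v zero) (ih inside)) ⟩
    Q outside + v zero * Q inside
      ≈⟨ weighted-suc h v ⟨
    weighted h v ∎
    where
    P Q : Bool → Carrier
    P b = pairs inside (h ∘ (b ∷_)) (w ∘ suc) (u ∘ suc)
    Q b = weighted (h ∘ (b ∷_)) (v ∘ suc)
    ih : ∀ b → P b ≈ Q b
    ih b = pairs-inside (h ∘ (b ∷_)) (w+u≈v ∘ suc)

  -- Here the states "in neither" and "in `F`" both lead to `P outside`, with total coefficient
  -- `1# + w zero`, which `r zero` normalises to `1#`. The intended values are `r = v / u` and
  -- `w = u / v - 1`; stating only their two equations keeps division out of the induction.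
  pairs-outside : ∀ {m} (h : Subset m → Carrier) (r w u v : Fin m → Carrier) →
                  (∀ e → r e * (1# + w e) ≈ 1#) → (∀ e → r e * u e ≈ v e) →
                  (∏[ e ∈ ⊤ ] r e) * pairs outside h w u ≈ weighted h v
  -- Two empty products disappear: the prefactor and the weight of the empty `F`.
  pairs-outside {zero}  h _ _ _ _ _ _ = ≈-trans (*-identityˡ _) (*-identityˡ _)
  pairs-outside {suc m} h r w u v r[1+w]≈1 ru≈v = begin
    (r zero * ρ) * pairs outside h w u
      ≈⟨ *-congˡ (pairs-suc outside h w u) ⟩
    (r zero * ρ) * ((P outside + u zero * P inside) + w zero * P outside)
      ≈⟨ solve 6 (λ r ρ u w p q → (r :* ρ) :* ((p :+ u :* q) :+ w :* p) :=
                    (r :* (con 1 :+ w)) :* (ρ :* p) :+ (r :* u) :* (ρ :* q))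
           ≈-refl (r zero) ρ (u zero) (w zero) (P outside) (P inside) ⟩
    (r zero * (1# + w zero)) * (ρ * P outside) + (r zero * u zero) * (ρ * P inside)
      ≈⟨ +-cong (*-cong (r[1+w]≈1 zero) (ih outside)) (*-cong (ru≈v zero) (ih inside)) ⟩
    1# * Q outside + v zero * Q inside
      ≈⟨ +-congʳ (*-identityˡ (Q outside)) ⟩
    Q outside + v zero * Q inside
      ≈⟨ weighted-suc h v ⟨
    weighted h v ∎
    where
    ρ : Carrier
    ρ = ∏[ e ∈ ⊤ ] r (suc e)
    P Q : Bool → Carrier
    P b = pairs outside (h ∘ (b ∷_)) (w ∘ suc) (u ∘ suc)
    Q b = weighted (h ∘ (b ∷_)) (v ∘ suc)
    ih : ∀ b → ρ * P b ≈ Q b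
    ih b = pairs-outside (h ∘ (b ∷_)) (r ∘ suc) (w ∘ suc) (u ∘ suc) (v ∘ suc)
                         (r[1+w]≈1 ∘ suc) (ru≈v ∘ suc)

  -- Division and the two identities.

  -‿cancel : ∀ x y → (x - y) + y ≈ x
  -‿cancel x y = GroupProperties.//-rightDividesˡ +-group y x

  /-inverse : ∀ x y (x#0 : x # 0#) (y#0 : y # 0#) → (x / y ⟨ y#0 ⟩) * (y / x ⟨ x#0 ⟩) ≈ 1#
  /-inverse x y x#0 y#0 = begin
    (x / y ⟨ y#0 ⟩) * (y / x ⟨ x#0 ⟩)        ≈⟨ *-assoc _ _ _ ⟨
    (x / y ⟨ y#0 ⟩) * y * _                  ≈⟨ *-congʳ (/-cancel x y y#0) ⟩
    x * _                                    ≈⟨ *-comm _ _ ⟩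
    -- The factor `_` is the chosen inverse of `x`; rewritten as `1# / x` it falls under `/-cancel`.
    _ * x                                    ≈⟨ *-congʳ (*-identityˡ _) ⟨
    (1# / x ⟨ x#0 ⟩) * x                     ≈⟨ /-cancel 1# x x#0 ⟩
    1#                                       ∎

  deletion : ∀ G q (v u : Fin (E G) → Carrier) (v≠0 : ∀ e → v e # 0#) (u≠0 : ∀ e → u e # 0#) →
    Z G q v ≈ (∏[ e ∈ ⊤ ] (v e / u e ⟨ u≠0 e ⟩)) *
              (∑[ F ] ((∏[ e ∈ F ] (u e / v e ⟨ v≠0 e ⟩ - 1#)) * Z (G -ᴳ F) q (u ∖ F)))
  deletion G q v u v≠0 u≠0 = ≈-sym (≈-trans
    -- `k-delete` moves each exponent to a subgraph of `G`, which turns the sum into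
    -- `pairs outside`.
    (*-congˡ (∑-cong λ F → *-congˡ {∏[ e ∈ F ] w e} (∑-cong λ B →
      *-congʳ {∏[ i ∈ B ] (u ∖ F) i} (reflexive (cong (q ^_) (k-delete G F B))))))
    (pairs-outside (λ A → q ^ k G A) (λ e → v e / u e ⟨ u≠0 e ⟩) w u v
      -- `1 + (u/v - 1)` is `u/v`, the inverse of the prefactor `v/u`.
      (λ e → ≈-trans (*-congˡ (≈-trans (+-comm 1# (w e)) (-‿cancel (u e / v e ⟨ v≠0 e ⟩) 1#)))
                     (/-inverse (v e) (u e) (v≠0 e) (u≠0 e)))
      (λ e → /-cancel (v e) (u e) (u≠0 e))))
    where
    w : Fin (E G) → Carrier
    w e = u e / v e ⟨ v≠0 e ⟩ - 1#

  contraction : ∀ G q (v u : Fin (E G) → Carrier) →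
    Z G q v ≈ (∑[ F ] ((∏[ e ∈ F ] (v e - u e)) * Z (G /ᴳ F) q (u ∖ F)))
  contraction G q v u = ≈-sym (≈-trans
    (∑-cong λ F → *-congˡ {∏[ e ∈ F ] (v e - u e)} (∑-cong λ B →
      *-congʳ {∏[ i ∈ B ] (u ∖ F) i} (reflexive (cong (q ^_) (k-contract G F B)))))
    (pairs-inside (λ A → q ^ k G A) (λ e → -‿cancel (v e) (u e))))

theorem1p2 : ∀ {c ℓ₁ ℓ₂} (K : HeytingField c ℓ₁ ℓ₂) →
  let open HeytingField K
      open Potts K
  in (G : Graph) (q : Carrier) (v u : Fin (E G) → Carrier) →
     ((v≠0 : ∀ e → v e # 0#) (u≠0 : ∀ e → u e # 0#) →
       Z G q v ≈
         (∏[ e ∈ ⊤ ] (v e / u e ⟨ u≠0 e ⟩)) *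
         (∑[ F ] ((∏[ e ∈ F ] (u e / v e ⟨ v≠0 e ⟩ - 1#)) * Z (G -ᴳ F) q (u ∖ F))))
     ×
     (Z G q v ≈ (∑[ F ] ((∏[ e ∈ F ] (v e - u e)) * Z (G /ᴳ F) q (u ∖ F))))
theorem1p2 K G q v u = Expansion.deletion K G q v u , Expansion.contraction K G q v u
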